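{- Let $\mathcal{M}$ and $\mathcal{N}$ be matroids on the same finite ground set $V$, and let $k\ge1$ be an integer. If $r(\mathcal{M}[X])+r(\mathcal{N}[V\setminus X])\ge k+1$ for all $X\subseteq V$ for which $V\setminus X$ is a flat of $\mathcal{N}$ of rank at most $k-1$, then $\mathbf{RG}(\mathcal{M},\mathcal{N};k)$ is connected.
   Context: $\mathcal{M}[X]=\{A\in\mathcal{M}:A\subseteq X\}$ and $r$ is matroid rank. A flat of $\mathcal{N}$ is $F\subseteq V$ with $r(\mathcal{N}[F\cup\{x\}])>r(\mathcal{N}[F])$ for every $x\in V\setminus F$. $\mathbf{RG}(\mathcal{M},\mathcal{N};k)$ is the graph whose vertices are the common independent sets of $\mathcal{M}$ and $\mathcal{N}$ of cardinality $k$, two such sets $S,T$ being adjacent if $S\cup T$ is an independent set of $\mathcal{M}$ of cardinality $k+1$. -}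

module Defs where

open import Data.Fin.Subset using (Subset; inside; outside; _∈_; _∉_; _⊆_; _∪_; ⊥; ⁅_⁆; ∣_∣)
open import Data.Fin.Subset.Properties using (⊥⊆; ⊆-trans; _⊆?_; x∈p∪q⁻; x∈⁅y⁆⇒x≡y; ∪-comm; ∪-idem)
open import Data.List.Base using (List; []; _∷_; _++_; map; filter)
open import Data.List.Extrema.Nat using (max)
open import Data.Nat.Base using (ℕ; zero; suc; _+_; _<_; _>_)
open import Data.Nat.Properties using (m≢1+m+n; +-comm)
open import Data.Product.Base using (∃; _×_; _,_; proj₁; proj₂)
open import Data.Sum.Base using ([_,_]′)
open import Data.Vec.Base using ([]; _∷_)
open import Relation.Binary.Construct.Closure.ReflexiveTransitive using (Star)
open import Relation.Binary.PropositionalEquality using (_≡_; sym; trans; cong; subst)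
open import Relation.Nullary.Decidable using (_×-dec_)
open import Relation.Nullary.Negation using (¬_)
open import Relation.Unary using (Decidable)

-- The ground set is Fin n.  Independence is decidable, as it is classically
-- for any family of subsets of a finite set.
record Matroid (n : ℕ) : Set₁ where
  field
    Indep      : Subset n → Set
    indep?     : Decidable Indep
    ⊥-indep    : Indep ⊥
    hereditary : ∀ {I J} → I ⊆ J → Indep J → Indep I
    augment    : ∀ {I J} → Indep I → Indep J → ∣ I ∣ < ∣ J ∣ →
                 ∃ λ x → x ∈ J × x ∉ I × Indep (I ∪ ⁅ x ⁆)

open Matroid public

-- M [ X ] keeps the ground set Fin n; elements outside X become loops.
infix 25 _[_]
_[_] : ∀ {n} → Matroid n → Subset n → Matroid n
Indep      (M [ X ]) A = Indep M A × A ⊆ X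
indep?     (M [ X ]) A = indep? M A ×-dec A ⊆? X
⊥-indep    (M [ X ]) = ⊥-indep M , ⊥⊆
hereditary (M [ X ]) I⊆J (J-indep , J⊆X) = hereditary M I⊆J J-indep , ⊆-trans I⊆J J⊆X
augment    (M [ X ]) {I} {J} (I-indep , I⊆X) (J-indep , J⊆X) ∣I∣<∣J∣ =
  let (x , x∈J , x∉I , I∪x-indep) = augment M I-indep J-indep ∣I∣<∣J∣
  in x , x∈J , x∉I , I∪x-indep ,
     λ y∈I∪x → [ (λ y∈I → I⊆X y∈I)
               , (λ y∈x → subst (_∈ X) (sym (x∈⁅y⁆⇒x≡y x y∈x)) (J⊆X x∈J))
               ]′ (x∈p∪q⁻ I ⁅ x ⁆ y∈I∪x)

allSubsets : ∀ n → List (Subset n)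
allSubsets zero    = [] ∷ []
allSubsets (suc n) = map (outside ∷_) (allSubsets n) ++ map (inside ∷_) (allSubsets n)

-- The maximum cardinality of an independent set; the default value 0 of max
-- is ∣ ⊥ ∣, and ⊥ is always independent.
rank : ∀ {n} → Matroid n → ℕ
rank {n} M = max 0 (map ∣_∣ (filter (indep? M) (allSubsets n)))

IsFlat : ∀ {n} → Matroid n → Subset n → Set
IsFlat N F = ∀ x → x ∉ F → rank (N [ F ∪ ⁅ x ⁆ ]) > rank (N [ F ])

-- Simple graphs whose vertex set is a subset of A.  Being a vertex is a
-- predicate, so that vertices are compared as elements of A and not together
-- with a proof of vertexhood.
record Graph (A : Set) : Set₁ where
  field
    IsVertex   : A → Set
    Adj        : A → A → Set
    adj-vertex : ∀ {s t} → Adj s t → IsVertex s × IsVertex t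
    adj-sym    : ∀ {s t} → Adj s t → Adj t s
    adj-irrefl : ∀ {s} → ¬ Adj s s

-- The empty graph is not connected.
Connected : ∀ {A} → Graph A → Set
Connected G = ∃ IsVertex × (∀ {s t} → IsVertex s → IsVertex t → Star Adj s t)
  where open Graph G

RGVertex : ∀ {n} → Matroid n → Matroid n → ℕ → Subset n → Set
RGVertex M N k S = Indep M S × Indep N S × ∣ S ∣ ≡ k

RG : ∀ {n} → Matroid n → Matroid n → ℕ → Graph (Subset n)
RG M N k = record
  { IsVertex   = RGVertex M N k
  ; Adj        = λ S T → (RGVertex M N k S × RGVertex M N k T)
                         × Indep M (S ∪ T) × ∣ S ∪ T ∣ ≡ k + 1
  ; adj-vertex = proj₁
  ; adj-sym    = λ {S} {T} ((vS , vT) , S∪T-indep , ∣S∪T∣≡k+1) →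
      (vT , vS)
      , subst (Indep M) (∪-comm S T) S∪T-indep
      , trans (cong ∣_∣ (∪-comm T S)) ∣S∪T∣≡k+1
  ; adj-irrefl = λ {S} (((_ , _ , ∣S∣≡k) , _) , _ , ∣S∪S∣≡k+1) →
      m≢1+m+n k {0}
        (trans (sym ∣S∣≡k)
        (trans (cong ∣_∣ (sym (∪-idem S)))
        (trans ∣S∪S∣≡k+1
        (trans (+-comm k 1) (cong suc (+-comm 0 k))))))
  }

{-# OPTIONS --safe #-}
module Submission where

-- To join vertices S and T, keep a set I ⊆ S ∩ T and enlarge it until S = I = T.
-- If some t ∈ T is not M-spanned by S, exchanging it into S keeps I and puts t
-- into the intersection.  Otherwise every x outside cl_M(S) is also outside
-- cl_M(T).  If such an x is outside cl_N(I), exchange it into S while keeping I: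
-- the new set does not span T, so the previous case applies.  If there is no
-- such x, follow a chordless path of the matroid intersection exchange graph
-- from V ∖ cl_M(S) to V ∖ cl_N(I) whose inner exchanges replace y ∈ I by x, in
-- S and T simultaneously; each of them is a pair of edges of RG and shortens
-- the path.  If no path existed, some J ⊆ I would satisfy
-- V ∖ cl_N(J) ⊆ cl_M(S ∖ J), and the flat cl_N(J) would violate the rank
-- condition.  The same paths with I = S augment common independent sets of
-- size < k, so that a vertex exists.

open import Defs
open import Data.Fin.Base using (Fin; zero; suc)
open import Data.Fin.Properties using (any?) renaming (_≟_ to _≟ᶠ_)
open import Data.Fin.Subset using (Subset; inside; outside; _∈_; _∉_; _⊆_; _∪_; _─_; _-_; ⁅_⁆; ∣_∣; ∁)
open import Data.Fin.Subset.Properties using (_∈?_; ⊥⊆; ∣⊥∣≡0; x∈⁅x⁆; x∈⁅y⁆⇒x≡y; ∣⁅x⁆∣≡1; ⊆-antisym; p⊆q⇒∣p∣≤∣q∣; p⊂q⇒∣p∣<∣q∣; x∈p∪q⁻; p⊆p∪q; q⊆p∪q; p─q⊆p; x∈p∧x∉q⇒x∈p─q; x∈p∧x≢y⇒x∈p-y; drop-there; drop-∷-⊆; x∈p⇒∣p-x∣<∣p∣; x∈∁p⇒x∉p; x∉∁p⇒x∈p)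
open import Data.List.Base using (List; []; _∷_; map; filter)
open import Data.List.Extrema.Nat using (xs≤max; argmax-sel)
import Data.List.Membership.Propositional as List
open import Data.List.Membership.Propositional.Properties using (∈-map⁺; ∈-map⁻; ∈-++⁺ˡ; ∈-++⁺ʳ; ∈-filter⁺; ∈-filter⁻)
open import Data.List.Relation.Unary.All as All using (All; []; _∷_)
open import Data.List.Relation.Unary.Any using (here)
open import Data.Nat.Base using (ℕ; zero; suc; _+_; _∸_; _≤_; _<_; _≥_; z≤n; s≤s)
open import Data.Nat.Properties
open import Data.Product.Base using (∃; ∃₂; _×_; _,_; proj₁; proj₂)
open import Data.Sum.Base using (_⊎_; inj₁; inj₂; [_,_]′)
open import Data.Vec.Base using ([]; _∷_; here; there)
open import Function.Base using (id; _∘_)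
open import Relation.Binary.Construct.Closure.ReflexiveTransitive using (Star; ε; _◅_; _◅◅_)
open import Relation.Binary.PropositionalEquality using (_≡_; refl; sym; trans; cong; subst)
open import Relation.Nullary using (Dec; yes; no; ¬_; contradiction)
open import Relation.Nullary.Decidable using (_×-dec_; ¬?; decidable-stable)

private variable
  n : ℕ
  x y z : Fin n
  X Y S I J : Subset n

-- Adding and removing elements of finite subsets.

infixl 5 _⊕_
_⊕_ : Subset n → Fin n → Subset n
X ⊕ x = X ∪ ⁅ x ⁆

x∈X⊕x : x ∈ X ⊕ x
x∈X⊕x {x = x} {X} = q⊆p∪q X ⁅ x ⁆ (x∈⁅x⁆ x)

X⊆X⊕x : X ⊆ X ⊕ x
X⊆X⊕x {x = x} = p⊆p∪q ⁅ x ⁆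

∈-⊕⁻ : z ∈ X ⊕ x → z ∈ X ⊎ z ≡ x
∈-⊕⁻ {X = X} {x} z∈ with x∈p∪q⁻ X ⁅ x ⁆ z∈
... | inj₁ z∈X = inj₁ z∈X
... | inj₂ z∈x = inj₂ (x∈⁅y⁆⇒x≡y x z∈x)

⊕-⊆ : X ⊆ Y → x ∈ Y → X ⊕ x ⊆ Y
⊕-⊆ X⊆Y x∈Y z∈ with ∈-⊕⁻ z∈
... | inj₁ z∈X  = X⊆Y z∈X
... | inj₂ refl = x∈Y

⊕-mono : X ⊆ Y → X ⊕ x ⊆ Y ⊕ x
⊕-mono X⊆Y = ⊕-⊆ (X⊆X⊕x ∘ X⊆Y) x∈X⊕x

x∈X─Y⇒x∉Y : ∀ (X Y : Subset n) → x ∈ X ─ Y → x ∉ Y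
x∈X─Y⇒x∉Y (_ ∷ _) (inside ∷ _)  ()        here
x∈X─Y⇒x∉Y (_ ∷ X) (_ ∷ Y)       (there p) (there q) = x∈X─Y⇒x∉Y X Y p q

X-y⊆X : X - y ⊆ X
X-y⊆X {X = X} {y} = p─q⊆p X ⁅ y ⁆

y∉X-y : y ∉ X - y
y∉X-y {y = y} {X} y∈ = x∈X─Y⇒x∉Y X ⁅ y ⁆ y∈ (x∈⁅x⁆ y)

-‿mono : X ⊆ Y → X - y ⊆ Y - y
-‿mono X⊆Y z∈ = x∈p∧x≢y⇒x∈p-y (X⊆Y (X-y⊆X z∈)) λ { refl → y∉X-y z∈ }

X⊆X-y⊕y : X ⊆ X - y ⊕ y
X⊆X-y⊕y {y = y} {x = z} z∈X with z ≟ᶠ y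
... | yes refl = x∈X⊕x
... | no z≢y   = X⊆X⊕x (x∈p∧x≢y⇒x∈p-y z∈X z≢y)

∣X─Y∣+∣Y∣≡∣X∣ : ∀ (X Y : Subset n) → Y ⊆ X → ∣ X ─ Y ∣ + ∣ Y ∣ ≡ ∣ X ∣
∣X─Y∣+∣Y∣≡∣X∣ []            []            Y⊆X = refl
∣X─Y∣+∣Y∣≡∣X∣ (inside ∷ X)  (inside ∷ Y)  Y⊆X =
  trans (+-suc ∣ X ─ Y ∣ ∣ Y ∣) (cong suc (∣X─Y∣+∣Y∣≡∣X∣ X Y (drop-∷-⊆ Y⊆X)))
∣X─Y∣+∣Y∣≡∣X∣ (outside ∷ X) (inside ∷ Y)  Y⊆X with () ← Y⊆X here
∣X─Y∣+∣Y∣≡∣X∣ (inside ∷ X)  (outside ∷ Y) Y⊆X = cong suc (∣X─Y∣+∣Y∣≡∣X∣ X Y (drop-∷-⊆ Y⊆X))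
∣X─Y∣+∣Y∣≡∣X∣ (outside ∷ X) (outside ∷ Y) Y⊆X = ∣X─Y∣+∣Y∣≡∣X∣ X Y (drop-∷-⊆ Y⊆X)

1+∣X-y∣≡∣X∣ : y ∈ X → suc ∣ X - y ∣ ≡ ∣ X ∣
1+∣X-y∣≡∣X∣ {y = y} {X} y∈X =
  trans (+-comm 1 _) (trans (cong (∣ X - y ∣ +_) (sym (∣⁅x⁆∣≡1 y)))
    (∣X─Y∣+∣Y∣≡∣X∣ X ⁅ y ⁆ λ z∈y → subst (_∈ X) (sym (x∈⁅y⁆⇒x≡y y z∈y)) y∈X))

∣X⊕x∣≡1+∣X∣ : x ∉ X → ∣ X ⊕ x ∣ ≡ suc ∣ X ∣
∣X⊕x∣≡1+∣X∣ {x = x} {X} x∉X = trans (sym (1+∣X-y∣≡∣X∣ {y = x} {X ⊕ x} (x∈X⊕x {X = X}))) (cong (suc ∘ ∣_∣) X⊕x-x≡X)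
  where
  X⊕x-x≡X : X ⊕ x - x ≡ X
  X⊕x-x≡X = ⊆-antisym
    (λ z∈ → [ id , (λ { refl → contradiction z∈ y∉X-y }) ]′ (∈-⊕⁻ (X-y⊆X z∈)))
    (λ z∈X → x∈p∧x≢y⇒x∈p-y (X⊆X⊕x z∈X) λ { refl → x∉X z∈X })

X⊆Y∧∣Y∣≤∣X∣⇒X≡Y : X ⊆ Y → ∣ Y ∣ ≤ ∣ X ∣ → X ≡ Y
X⊆Y∧∣Y∣≤∣X∣⇒X≡Y {X = X} X⊆Y ∣Y∣≤∣X∣ = ⊆-antisym X⊆Y λ {z} z∈Y →
  decidable-stable (z ∈? X) λ z∉X → <⇒≱ (p⊂q⇒∣p∣<∣q∣ (X⊆Y , z , z∈Y , z∉X)) ∣Y∣≤∣X∣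

∈-allSubsets : ∀ (X : Subset n) → X List.∈ allSubsets n
∈-allSubsets []            = here refl
∈-allSubsets (outside ∷ X) = ∈-++⁺ˡ (∈-map⁺ _ (∈-allSubsets X))
∈-allSubsets (inside ∷ X)  = ∈-++⁺ʳ _ (∈-map⁺ _ (∈-allSubsets X))

⟦_⟧ : {P : Fin n → Set} → (∀ x → Dec (P x)) → Subset n
⟦_⟧ {n = zero}  P? = []
⟦_⟧ {n = suc n} P? with P? zero
... | yes _ = inside ∷ ⟦ P? ∘ suc ⟧
... | no _  = outside ∷ ⟦ P? ∘ suc ⟧

∈-⟦⟧⁺ : {P : Fin n → Set} (P? : ∀ x → Dec (P x)) → P x → x ∈ ⟦ P? ⟧
∈-⟦⟧⁺ {x = zero} P? px with P? zero
... | yes _   = here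
... | no ¬px  = contradiction px ¬px
∈-⟦⟧⁺ {x = suc x} P? px with P? zero
... | yes _ = there (∈-⟦⟧⁺ (P? ∘ suc) px)
... | no _  = there (∈-⟦⟧⁺ (P? ∘ suc) px)

∈-⟦⟧⁻ : {P : Fin n → Set} (P? : ∀ x → Dec (P x)) → x ∈ ⟦ P? ⟧ → P x
∈-⟦⟧⁻ {x = zero} P? x∈ with P? zero | x∈
... | yes px | _ = px
... | no _   | ()
∈-⟦⟧⁻ {x = suc x} P? x∈ with P? zero
... | yes _ = ∈-⟦⟧⁻ (P? ∘ suc) (drop-there x∈)
... | no _  = ∈-⟦⟧⁻ (P? ∘ suc) (drop-there x∈)

-- Rank and closure in a matroid.

module Closure {n : ℕ} (M : Matroid n) where

  r : Subset n → ℕ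
  r X = rank (M [ X ])

  indep⇒∣I∣≤r : Indep M I → I ⊆ X → ∣ I ∣ ≤ r X
  indep⇒∣I∣≤r {I} {X} I-indep I⊆X = All.lookup (xs≤max 0 _)
    (∈-map⁺ ∣_∣ (∈-filter⁺ (indep? (M [ X ])) (∈-allSubsets I) (I-indep , I⊆X)))

  basis : ∀ X → ∃ λ B → Indep M B × B ⊆ X × ∣ B ∣ ≡ r X
  basis X with argmax-sel id 0 (map ∣_∣ (filter (indep? (M [ X ])) (allSubsets n)))
  -- The maximum may be the default 0 of `max`; the empty set then attains it.
  ... | inj₁ r≡0 = _ , ⊥-indep M , ⊥⊆ , trans (∣⊥∣≡0 n) (sym r≡0)
  ... | inj₂ r∈  =
    let B , B∈ , r≡∣B∣ = ∈-map⁻ ∣_∣ r∈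
        _ , B-indep , B⊆X = ∈-filter⁻ (indep? (M [ X ])) {xs = allSubsets n} B∈
    in B , B-indep , B⊆X , sym r≡∣B∣

  r≤∣X∣ : r X ≤ ∣ X ∣
  r≤∣X∣ {X} = let B , _ , B⊆X , ∣B∣≡r = basis X in subst (_≤ ∣ X ∣) ∣B∣≡r (p⊆q⇒∣p∣≤∣q∣ B⊆X)

  r-mono : X ⊆ Y → r X ≤ r Y
  r-mono {X} {Y} X⊆Y = let B , B-indep , B⊆X , ∣B∣≡r = basis X in
    subst (_≤ r Y) ∣B∣≡r (indep⇒∣I∣≤r B-indep (X⊆Y ∘ B⊆X))

  extend : Indep M I → Indep M J → ∣ I ∣ ≤ ∣ J ∣ →
           ∃ λ A → Indep M A × I ⊆ A × A ⊆ I ∪ J × ∣ A ∣ ≡ ∣ J ∣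
  extend {I} {J} I-indep J-indep ∣I∣≤∣J∣ = go (∣ J ∣ ∸ ∣ I ∣) I-indep id (p⊆p∪q J) (m∸n+n≡m ∣I∣≤∣J∣)
    where
    go : ∀ d {A} → Indep M A → I ⊆ A → A ⊆ I ∪ J → d + ∣ A ∣ ≡ ∣ J ∣ →
         ∃ λ A → Indep M A × I ⊆ A × A ⊆ I ∪ J × ∣ A ∣ ≡ ∣ J ∣
    go zero    {A} A-indep I⊆A A⊆I∪J eq = A , A-indep , I⊆A , A⊆I∪J , eq
    go (suc d) {A} A-indep I⊆A A⊆I∪J eq =
      let x , x∈J , x∉A , A⊕x-indep = augment M A-indep J-indep (subst (∣ A ∣ <_) eq (s≤s (m≤n+m ∣ A ∣ d)))
      in go d A⊕x-indep (X⊆X⊕x ∘ I⊆A) (⊕-⊆ A⊆I∪J (q⊆p∪q I J x∈J))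
           (trans (cong (d +_) (∣X⊕x∣≡1+∣X∣ x∉A)) (trans (+-suc d ∣ A ∣) eq))

  r-⊕-≤ : r (X ⊕ x) ≤ suc (r X)
  r-⊕-≤ {X} {x} with basis (X ⊕ x)
  ... | B , B-indep , B⊆X⊕x , ∣B∣≡r = subst (_≤ suc (r X)) ∣B∣≡r (lemma (x ∈? B))
    where
    lemma : Dec (x ∈ B) → ∣ B ∣ ≤ suc (r X)
    lemma (yes x∈B) = subst (_≤ suc (r X)) (1+∣X-y∣≡∣X∣ x∈B) (s≤s (indep⇒∣I∣≤r {I = B - x} (hereditary M X-y⊆X B-indep)
      λ z∈ → [ id , (λ { refl → contradiction z∈ y∉X-y }) ]′ (∈-⊕⁻ (B⊆X⊕x (X-y⊆X z∈)))))
    lemma (no x∉B)  = m≤n⇒m≤1+n (indep⇒∣I∣≤r B-indep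
      λ z∈ → [ id , (λ { refl → contradiction z∈ x∉B }) ]′ (∈-⊕⁻ (B⊆X⊕x z∈)))

  -- As `r` is monotone, the inequality is an equality: this is the usual matroid closure.
  Cl : Subset n → Fin n → Set
  Cl X x = r (X ⊕ x) ≤ r X

  cl? : ∀ X x → Dec (Cl X x)
  cl? X x = r (X ⊕ x) ≤? r X

  cl-extensive : x ∈ X → Cl X x
  cl-extensive x∈X = r-mono (⊕-⊆ id x∈X)

  -- A basis `B` of `X` extends to a basis `A` of `Y`. If `x` raises the rank of `Y`, the element
  -- augmenting `A` can only be `x`, so `B ⊕ x` is independent too.
  cl-mono : X ⊆ Y → Cl X x → Cl Y x
  cl-mono {X} {Y} {x} X⊆Y X∋x = ≮⇒≥ λ rY<rY⊕x → <⇒≱ (lemma rY<rY⊕x) X∋x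
    where
    lemma : r Y < r (Y ⊕ x) → r X < r (X ⊕ x)
    lemma rY<rY⊕x with basis X | basis Y | basis (Y ⊕ x)
    ... | B , B-indep , B⊆X , ∣B∣≡rX | C , C-indep , C⊆Y , ∣C∣≡rY | D , D-indep , D⊆Y⊕x , ∣D∣≡rY⊕x
      with extend B-indep C-indep (subst (_≤ ∣ C ∣) (sym ∣B∣≡rX) (subst (r X ≤_) (sym ∣C∣≡rY) (r-mono X⊆Y)))
    ... | A , A-indep , B⊆A , A⊆B∪C , ∣A∣≡∣C∣
      with augment M A-indep D-indep (subst (_< ∣ D ∣) (trans (sym ∣C∣≡rY) (sym ∣A∣≡∣C∣)) (subst (r Y <_) (sym ∣D∣≡rY⊕x) rY<rY⊕x))
    ... | d , d∈D , d∉A , A⊕d-indep = subst (_< r (X ⊕ x)) ∣B∣≡rX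
      (subst (_≤ r (X ⊕ x)) (∣X⊕x∣≡1+∣X∣ (d∉A ∘ B⊆A))
        (indep⇒∣I∣≤r (hereditary M (⊕-mono B⊆A) A⊕d-indep)
          (⊕-⊆ (X⊆X⊕x ∘ B⊆X) (subst (λ w → w ∈ X ⊕ x) (sym d≡x) x∈X⊕x))))
      where
      A⊆Y : A ⊆ Y
      A⊆Y a∈A = [ X⊆Y ∘ B⊆X , C⊆Y ]′ (x∈p∪q⁻ B C (A⊆B∪C a∈A))
      d∉Y : d ∉ Y
      d∉Y d∈Y = <⇒≱ (subst (_≤ r Y) (trans (∣X⊕x∣≡1+∣X∣ d∉A) (cong suc (trans ∣A∣≡∣C∣ ∣C∣≡rY)))
        (indep⇒∣I∣≤r A⊕d-indep (⊕-⊆ A⊆Y d∈Y))) ≤-refl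
      d≡x : d ≡ x
      d≡x = [ (λ d∈Y → contradiction d∈Y d∉Y) , id ]′ (∈-⊕⁻ (D⊆Y⊕x d∈D))

  spanned⇒r≤ : (∀ {y} → y ∈ Y → Cl X y) → r Y ≤ r X
  spanned⇒r≤ {Y} {X} Y⊆clX with basis X | basis Y
  ... | B , B-indep , B⊆X , ∣B∣≡rX | C , C-indep , C⊆Y , ∣C∣≡rY = ≮⇒≥ λ rX<rY →
    let c , c∈C , c∉B , B⊕c-indep = augment M B-indep C-indep
          (subst (_< ∣ C ∣) (sym ∣B∣≡rX) (subst (r X <_) (sym ∣C∣≡rY) rX<rY))
    in <⇒≱ (subst (_≤ r (X ⊕ c)) (trans (∣X⊕x∣≡1+∣X∣ c∉B) (cong suc ∣B∣≡rX)) (indep⇒∣I∣≤r B⊕c-indep (⊕-mono B⊆X)))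
         (Y⊆clX (C⊆Y c∈C))

  cl-trans : (∀ {y} → y ∈ Y → Cl X y) → Cl Y z → Cl X z
  cl-trans {Y} {X} {z} Y⊆clX Y∋z = ≤-trans (r-mono (⊕-mono (p⊆p∪q Y)))
    (≤-trans (cl-mono (q⊆p∪q X Y) Y∋z)
      (spanned⇒r≤ λ w∈ → [ cl-extensive , Y⊆clX ]′ (x∈p∪q⁻ X Y w∈)))

  -- The rank of `X ⊕ z ⊕ x` is at most that of `X ⊕ x`, hence at most `suc (r X)`, which `X ⊕ z`
  -- already attains.
  cl-exchange : Cl (X ⊕ x) z → ¬ Cl X z → Cl (X ⊕ z) x
  cl-exchange X⊕x∋z X∌z = ≤-trans (r-mono (⊕-⊆ (⊕-mono X⊆X⊕x) (X⊆X⊕x x∈X⊕x)))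
    (≤-trans X⊕x∋z (≤-trans r-⊕-≤ (≰⇒> X∌z)))

  indep⇒∉cl : Indep M (X ⊕ x) → x ∉ X → ¬ Cl X x
  indep⇒∉cl {X} {x} X⊕x-indep x∉X = <⇒≱ (<-≤-trans (s≤s r≤∣X∣)
    (subst (_≤ r (X ⊕ x)) (∣X⊕x∣≡1+∣X∣ x∉X) (indep⇒∣I∣≤r X⊕x-indep id)))

  ∉cl⇒indep : Indep M X → ¬ Cl X x → Indep M (X ⊕ x)
  ∉cl⇒indep {X} {x} X-indep X∌x with basis (X ⊕ x)
  ... | B , B-indep , B⊆X⊕x , ∣B∣≡r
    with augment M X-indep B-indep (≤-<-trans (indep⇒∣I∣≤r X-indep id) (subst (r X <_) (sym ∣B∣≡r) (≰⇒> X∌x)))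
  ... | b , b∈B , b∉X , X⊕b-indep with ∈-⊕⁻ (B⊆X⊕x b∈B)
  ... | inj₁ b∈X  = contradiction b∈X b∉X
  ... | inj₂ refl = X⊕b-indep

  ∉cl-- : Indep M S → y ∈ S → ¬ Cl (S - y) y
  ∉cl-- S-indep y∈S = indep⇒∉cl (hereditary M (⊕-⊆ X-y⊆X y∈S) S-indep) y∉X-y

  -- The fundamental circuit of x in S lies in I ∪ {x}, and it avoids y.
  cl-∩ : Indep M S → y ∈ S → I ⊆ S → Cl I x → Cl (S - y) x → Cl (I - y) x
  cl-∩ {S} {y} {I} {x} S-indep y∈S I⊆S I∋x S-y∋x =
    decidable-stable (cl? (I - y) x) λ I-y∌x → ∉cl-- S-indep y∈S
      (cl-trans (λ w∈ → [ cl-extensive ∘ -‿mono I⊆S , (λ { refl → S-y∋x }) ]′ (∈-⊕⁻ w∈))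
        (cl-exchange (cl-mono X⊆X-y⊕y I∋x) I-y∌x))

  -- The elements of `J` are deleted one at a time; `cl-∩` keeps `z` in the closure.
  cl-─ : Indep M S → J ⊆ S → (∀ {y} → y ∈ J → Cl (S - y) z) → Cl S z → Cl (S ─ J) z
  cl-─ {S} {J} {z} S-indep J⊆S avoids S∋z = go (suc ∣ S ∣) id ≤-refl S∋z
    where
    go : ∀ d {W} → W ⊆ S → ∣ W ∣ < d → Cl W z → Cl (S ─ J) z
    go (suc d) {W} W⊆S (s≤s ∣W∣≤d) W∋z with any? (λ y → y ∈? W ×-dec y ∈? J)
    ... | yes (y , y∈W , y∈J) = go d (W⊆S ∘ X-y⊆X) (<-≤-trans (x∈p⇒∣p-x∣<∣p∣ y∈W) ∣W∣≤d)
                                  (cl-∩ S-indep (J⊆S y∈J) W⊆S W∋z (avoids y∈J))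
    ... | no W∩J≡∅            = cl-mono (λ w∈W → x∈p∧x∉q⇒x∈p─q (W⊆S w∈W) λ w∈J → W∩J≡∅ (_ , w∈W , w∈J)) W∋z

  escapes? : ∀ X Y → (∃ λ x → x ∈ X × ¬ Cl Y x) ⊎ (∀ {x} → x ∈ X → Cl Y x)
  escapes? X Y with any? (λ x → x ∈? X ×-dec ¬? (cl? Y x))
  ... | yes found  = inj₁ found
  ... | no ¬escape = inj₂ λ {x} x∈X → decidable-stable (cl? Y x) λ Y∌x → ¬escape (x , x∈X , Y∌x)

-- Chordless exchange paths and the exchanges along them.

module ExchangePath {n : ℕ} (M N : Matroid n) where

  private
    module M = Closure M
    module N = Closure N

  -- The path x → y₁ → z₁ → y₂ → z₂ → ⋯ → zₘ ∉ cl_N(I), where ps lists the pairs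
  -- (yᵢ , zᵢ): x → y means x ∉ cl_N(I - y), and y → z means z ∉ cl_M(S - y).
  -- The All component forbids chords.
  Path : Subset n → Subset n → Fin n → List (Fin n × Fin n) → Set
  Path S I x []             = ¬ N.Cl I x
  Path S I x ((y , z) ∷ ps) = y ∈ I × ¬ N.Cl (I - y) x × ¬ M.Cl (S - y) z ×
                              All (λ (y′ , z′) → N.Cl (I - y′) x × M.Cl (S - y) z′) ps ×
                              Path S I z ps

  path⇒∈I : ∀ ps → Path S I x ps → All (λ (y , _) → y ∈ I) ps
  path⇒∈I []       _                         = []
  path⇒∈I (_ ∷ ps) (y∈I , _ , _ , _ , path) = y∈I ∷ path⇒∈I ps path

  -- Cutting at the last `z′` that `y` points to leaves a suffix without further arrows from `y`.
  lastExit : ∀ y ps → Path S I z ps → All (λ (_ , z′) → M.Cl (S - y) z′) ps ⊎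
             ∃₂ λ z′ ps′ → ¬ M.Cl (S - y) z′ × All (λ (_ , z″) → M.Cl (S - y) z″) ps′ × Path S I z′ ps′
  lastExit y [] _ = inj₁ []
  lastExit {S = S} y ((_ , z) ∷ ps) (_ , _ , _ , _ , path) with lastExit y ps path
  ... | inj₂ exit   = inj₂ exit
  ... | inj₁ spanned with M.cl? (S - y) z
  ...   | yes S-y∋z = inj₁ (S-y∋z ∷ spanned)
  ...   | no S-y∌z  = inj₂ (z , ps , S-y∌z , spanned , path)

  -- Entering at the last `y` that `x` points to leaves no chord at `x`; chords from that `y` were
  -- already excluded.
  jump : ∀ x ps → Path S I z ps → All (λ (y , _) → N.Cl (I - y) x) ps ⊎ ∃ (Path S I x)
  jump x [] _ = inj₁ []
  jump {I = I} x ((y , z) ∷ ps) (y∈I , _ , S-y∌z , chordless , path) with jump x ps path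
  ... | inj₂ found    = inj₂ found
  ... | inj₁ spanned with N.cl? (I - y) x
  ...   | yes I-y∋x = inj₁ (I-y∋x ∷ spanned)
  ...   | no I-y∌x  = inj₂ (_ , y∈I , I-y∌x , S-y∌z , All.zip (spanned , All.map proj₂ chordless) , path)

  attach : y ∈ I → ¬ N.Cl (I - y) x → ∀ ps → ¬ M.Cl (S - y) z → All (λ (_ , z′) → M.Cl (S - y) z′) ps →
           Path S I z ps → ∃ (Path S I x)
  attach {x = x} y∈I I-y∌x ps S-y∌z spanned path with jump x ps path
  ... | inj₁ spanned′ = _ , y∈I , I-y∌x , S-y∌z , All.zip (spanned′ , spanned) , path
  ... | inj₂ found    = found

  -- Prepending a step to a chordless path may create chords; shortcut along the last ones.
  prepend : ∀ ps → y ∈ I → ¬ N.Cl (I - y) x → ¬ M.Cl (S - y) z → Path S I z ps → ∃ (Path S I x)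
  prepend {y = y} ps y∈I I-y∌x S-y∌z path with lastExit y ps path
  ... | inj₁ spanned                              = attach y∈I I-y∌x ps S-y∌z spanned path
  ... | inj₂ (_ , ps′ , S-y∌z′ , spanned , path′) = attach y∈I I-y∌x ps′ S-y∌z′ spanned path′

  module Step {S I : Subset n} {x y : Fin n} (S-indep : Indep M S) (I⊆S : I ⊆ S) (y∈I : y ∈ I)
              (S∌x : ¬ M.Cl S x) (I∋x : N.Cl I x) (I-y∌x : ¬ N.Cl (I - y) x) where

    x∉S : x ∉ S
    x∉S x∈S = S∌x (M.cl-extensive x∈S)

    -- Otherwise exchange would put `x` into the closure of `X ⊕ z`, hence of `S`.
    ∉cl-⊕ : X ⊆ S → ¬ M.Cl X z → M.Cl S z → ¬ M.Cl (X ⊕ x) z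
    ∉cl-⊕ X⊆S X∌z S∋z X⊕x∋z = S∌x (M.cl-trans
      (λ w∈ → [ M.cl-extensive ∘ X⊆S , (λ { refl → S∋z }) ]′ (∈-⊕⁻ w∈)) (M.cl-exchange X⊕x∋z X∌z))

    -- Together with `I-y′⊆cl`: for `y′ ∈ I` the exchange preserves the N-closure of `I - y′` if `x`
    -- already lies in it.
    I-y⊕x-y′⊆cl : ∀ {y′} → N.Cl (I - y′) x → ∀ {w} → w ∈ I - y ⊕ x - y′ → N.Cl (I - y′) w
    I-y⊕x-y′⊆cl I-y′∋x w∈ with ∈-⊕⁻ (X-y⊆X w∈)
    ... | inj₁ w∈I-y = N.cl-extensive (x∈p∧x≢y⇒x∈p-y (X-y⊆X w∈I-y) λ { refl → y∉X-y w∈ })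
    ... | inj₂ refl  = I-y′∋x

    I-y′⊆cl : ∀ {y′} → y′ ∈ I → N.Cl (I - y′) x → ∀ {w} → w ∈ I - y′ → N.Cl (I - y ⊕ x - y′) w
    I-y′⊆cl {y′} y′∈I I-y′∋x {w} w∈ with w ≟ᶠ y
    ... | no w≢y   = N.cl-extensive (x∈p∧x≢y⇒x∈p-y (X⊆X⊕x (x∈p∧x≢y⇒x∈p-y (X-y⊆X w∈) w≢y)) λ { refl → y∉X-y w∈ })
    -- Here `w` is `y`. As `x` is in the closure of `I - y′` but not of `I - y`, exchange recovers
    -- `y` from `x`.
    ... | yes refl = N.cl-mono
      (⊕-⊆ {X = I - y′ - w} (λ v∈ → x∈p∧x≢y⇒x∈p-y (X⊆X⊕x (-‿mono X-y⊆X v∈)) λ { refl → y∉X-y (X-y⊆X v∈) })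
            (x∈p∧x≢y⇒x∈p-y x∈X⊕x λ { refl → x∉S (I⊆S y′∈I) }))
      (N.cl-exchange {X = I - y′ - w} (N.cl-mono X⊆X-y⊕y I-y′∋x) (I-y∌x ∘ N.cl-mono (-‿mono X-y⊆X)))

    -- Chordlessness makes the rest of the path survive: the N-closures at later `y′` do not change,
    -- and later `z′` lie in the M-closure of `S - y`, so `∉cl-⊕` preserves arrows to them and
    -- `cl-∩` preserves missing ones.
    transfer : ∀ ps {w} → All (λ (y′ , z′) → N.Cl (I - y′) x × M.Cl (S - y) z′) ps →
               Path S I w ps → Path (S - y ⊕ x) (I - y ⊕ x) w ps
    transfer [] _ I∌w I′∋w = I∌w (N.cl-trans
      (λ v∈ → [ N.cl-extensive ∘ X-y⊆X , (λ { refl → I∋x }) ]′ (∈-⊕⁻ v∈)) I′∋w)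
    transfer ((y′ , z′) ∷ ps) {w} ((I-y′∋x , S-y∋z′) ∷ chordless) (y′∈I , I-y′∌w , S-y′∌z′ , chordless′ , path) =
        X⊆X⊕x (x∈p∧x≢y⇒x∈p-y y′∈I λ { refl → I-y∌x I-y′∋x })
      , (λ I′∋w → I-y′∌w (N.cl-trans (I-y⊕x-y′⊆cl I-y′∋x) I′∋w))
      , (λ S′∋z′ → ∉cl-⊕ X-y⊆X S-y′∌z′ (M.cl-mono X-y⊆X S-y∋z′) (M.cl-mono S-y⊕x-y′⊆ S′∋z′))
      , All.zipWith (λ ((y″∈I , I-y″∋x , S-y∋z″) , (I-y″∋w , S-y′∋z″)) →
            N.cl-trans (I-y′⊆cl y″∈I I-y″∋x) I-y″∋w
          , M.cl-mono S-y′-y⊆ (M.cl-∩ S-indep (I⊆S y∈I) X-y⊆X S-y′∋z″ S-y∋z″))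
          (All.zip (path⇒∈I ps path , chordless) , chordless′)
      , transfer ps chordless path
      where
      S-y⊕x-y′⊆ : S - y ⊕ x - y′ ⊆ S - y′ ⊕ x
      S-y⊕x-y′⊆ v∈ with ∈-⊕⁻ (X-y⊆X v∈)
      ... | inj₁ v∈S-y = X⊆X⊕x (x∈p∧x≢y⇒x∈p-y (X-y⊆X v∈S-y) λ { refl → y∉X-y v∈ })
      ... | inj₂ refl  = x∈X⊕x
      S-y′-y⊆ : S - y′ - y ⊆ S - y ⊕ x - y′
      S-y′-y⊆ v∈ = x∈p∧x≢y⇒x∈p-y (X⊆X⊕x (-‿mono X-y⊆X v∈)) λ { refl → y∉X-y (X-y⊆X v∈) }

  -- The condition on `x` and `y` refers to `I` alone and passes by `cl-∩` to every N-independent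
  -- `S` containing `I`, so one exchange serves both ends of a walk.
  swap-indep : Indep N S → I ⊆ S → y ∈ I → N.Cl I x → ¬ N.Cl (I - y) x → Indep N (S - y ⊕ x)
  swap-indep S-indep I⊆S y∈I I∋x I-y∌x = N.∉cl⇒indep (hereditary N X-y⊆X S-indep)
    λ S-y∋x → I-y∌x (N.cl-∩ S-indep (I⊆S y∈I) I⊆S I∋x S-y∋x)

∣S-y⊕x∣≡∣S∣ : y ∈ S → x ∉ S → ∣ S - y ⊕ x ∣ ≡ ∣ S ∣
∣S-y⊕x∣≡∣S∣ {y = y} {S} y∈S x∉S = trans (∣X⊕x∣≡1+∣X∣ {X = S - y} (x∉S ∘ X-y⊆X)) (1+∣X-y∣≡∣X∣ y∈S)

-- Common independent sets and walks under the rank condition.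

module Reconfiguration {n : ℕ} (M N : Matroid n) (k : ℕ)
  (rank-condition : ∀ (X : Subset n) → IsFlat N (∁ X) → rank (N [ ∁ X ]) ≤ k ∸ 1 →
                    rank (M [ X ]) + rank (N [ ∁ X ]) ≥ k + 1) where

  open ExchangePath M N
  open Graph (RG M N k)
  private
    module M = Closure M
    module N = Closure N

  -- The rank condition is applied to `Z`, the complement of the flat spanned by `J` in `N`. If
  -- `S ─ J` spanned `Z` in `M`, the two ranks would sum to at most `∣ S ∣ ≤ k`.
  outside-both : J ⊆ S → ∣ J ∣ < k → ∣ S ∣ ≤ k → ∃ λ z → ¬ N.Cl J z × ¬ M.Cl (S ─ J) z
  outside-both {J} {S} J⊆S ∣J∣<k ∣S∣≤k with any? (λ z → ¬? (N.cl? J z) ×-dec ¬? (M.cl? (S ─ J) z))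
  ... | yes found = found
  ... | no ¬found = contradiction (rank-condition Z flat (≤-trans r≤∣J∣ (∸-monoˡ-≤ 1 ∣J∣<k))) (<⇒≱ (begin-strict
      M.r Z + N.r (∁ Z)    ≤⟨ +-mono-≤ (≤-trans (M.spanned⇒r≤ Z⊆cl) M.r≤∣X∣) r≤∣J∣ ⟩
      ∣ S ─ J ∣ + ∣ J ∣    ≡⟨ ∣X─Y∣+∣Y∣≡∣X∣ S J J⊆S ⟩
      ∣ S ∣                ≤⟨ ∣S∣≤k ⟩
      k                    <⟨ m<m+n k (s≤s z≤n) ⟩
      k + 1                ∎))
    where
    open ≤-Reasoning
    J∌? : ∀ z → Dec (¬ N.Cl J z)
    J∌? z = ¬? (N.cl? J z)
    Z : Subset n
    Z = ⟦ J∌? ⟧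
    Z⊆cl : ∀ {z} → z ∈ Z → M.Cl (S ─ J) z
    Z⊆cl {z} z∈Z = decidable-stable (M.cl? (S ─ J) z) λ S─J∌z → ¬found (z , ∈-⟦⟧⁻ J∌? z∈Z , S─J∌z)
    ∁Z⊆cl : ∀ {z} → z ∈ ∁ Z → N.Cl J z
    ∁Z⊆cl {z} z∈∁Z = decidable-stable (N.cl? J z) λ J∌z → x∈∁p⇒x∉p z∈∁Z (∈-⟦⟧⁺ J∌? J∌z)
    flat : IsFlat N (∁ Z)
    flat x x∉∁Z = ≰⇒> λ ∁Z∋x → ∈-⟦⟧⁻ J∌? (x∉∁p⇒x∈p x∉∁Z) (N.cl-trans ∁Z⊆cl ∁Z∋x)
    r≤∣J∣ : N.r (∁ Z) ≤ ∣ J ∣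
    r≤∣J∣ = ≤-trans (N.spanned⇒r≤ ∁Z⊆cl) N.r≤∣X∣

  -- Backward search: `J` holds the elements of `I` not yet reached, and every element outside the
  -- N-closure of `J` starts a path.
  path-exists : Indep M S → Indep N I → I ⊆ S → ∣ I ∣ < k → ∣ S ∣ ≤ k →
                ∃₂ λ x ps → ¬ M.Cl S x × Path S I x ps
  path-exists {S} {I} S-indep I-indep I⊆S ∣I∣<k ∣S∣≤k = go (suc ∣ I ∣) id ≤-refl λ I∌z → [] , I∌z
    where
    go : ∀ d {J} → J ⊆ I → ∣ J ∣ < d → (∀ {z} → ¬ N.Cl J z → ∃ (Path S I z)) →
         ∃₂ λ x ps → ¬ M.Cl S x × Path S I x ps
    go (suc d) {J} J⊆I (s≤s ∣J∣≤d) paths with outside-both (I⊆S ∘ J⊆I) (≤-<-trans (p⊆q⇒∣p∣≤∣q∣ J⊆I) ∣I∣<k) ∣S∣≤k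
    ... | z , J∌z , S─J∌z with M.cl? S z
    ...   | no S∌z  = let ps , path = paths J∌z in z , ps , S∌z , path
    ...   | yes S∋z with any? (λ y → y ∈? J ×-dec ¬? (M.cl? (S - y) z))
    -- Without an arrow from `J` to `z`, deleting all of `J` keeps `z` spanned, against the choice
    -- of `z`.
    ...     | no ¬exit = contradiction
                (M.cl-─ S-indep (I⊆S ∘ J⊆I) (λ {y} y∈J → decidable-stable (M.cl? (S - y) z) λ S-y∌z → ¬exit (y , y∈J , S-y∌z)) S∋z)
                S─J∌z
    ...     | yes (y , y∈J , S-y∌z) = go d (J⊆I ∘ X-y⊆X) (<-≤-trans (x∈p⇒∣p-x∣<∣p∣ y∈J) ∣J∣≤d) paths′
      where
      paths′ : ∀ {w} → ¬ N.Cl (J - y) w → ∃ (Path S I w)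
      paths′ {w} J-y∌w with N.cl? J w
      ... | no J∌w  = paths J∌w
      -- An element that leaves the closure when `y` leaves `J` has an arrow to `y`.
      ... | yes J∋w = let ps , path = paths J∌z in
        prepend ps (J⊆I y∈J) (λ I-y∋w → J-y∌w (N.cl-∩ I-indep (J⊆I y∈J) J⊆I J∋w I-y∋w)) S-y∌z path

  augment-common : Indep M S → Indep N S → ∣ S ∣ < k → ∃ λ S′ → Indep M S′ × Indep N S′ × ∣ S′ ∣ ≡ suc ∣ S ∣
  augment-common M-indep N-indep ∣S∣<k =
    let x , ps , S∌x , path = path-exists M-indep N-indep id ∣S∣<k (<⇒≤ ∣S∣<k) in go ps M-indep N-indep S∌x path
    where
    go : ∀ ps → Indep M S → Indep N S → ¬ M.Cl S x → Path S S x ps →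
         ∃ λ S′ → Indep M S′ × Indep N S′ × ∣ S′ ∣ ≡ suc ∣ S ∣
    go {S = S} {x} ps M-indep N-indep S∌x path with N.cl? S x
    ... | no N-S∌x = S ⊕ x , M.∉cl⇒indep M-indep S∌x , N.∉cl⇒indep N-indep N-S∌x
                   , ∣X⊕x∣≡1+∣X∣ (S∌x ∘ M.cl-extensive)
    go [] _ _ _ N-S∌x | yes N-S∋x = contradiction N-S∋x N-S∌x
    go {S = S} {x} ((y , z) ∷ ps) M-indep N-indep S∌x (y∈S , S-y∌x , S-y∌z , chordless , path) | yes N-S∋x with M.cl? S z
    -- Now `z` is itself a valid start, so the first pair is dropped.
    ... | no S∌z  = go ps M-indep N-indep S∌z path
    ... | yes S∋z =
      let S′ , M-indep′ , N-indep′ , ∣S′∣≡ = go ps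
            (hereditary M (⊕-mono X-y⊆X) (M.∉cl⇒indep M-indep S∌x))
            (swap-indep N-indep id y∈S N-S∋x S-y∌x)
            (∉cl-⊕ X-y⊆X S-y∌z S∋z) (transfer ps chordless path)
      in S′ , M-indep′ , N-indep′ , trans ∣S′∣≡ (cong suc (∣S-y⊕x∣≡∣S∣ y∈S x∉S))
      where open Step M-indep id y∈S S∌x N-S∋x S-y∌x

  common-indep : ∀ j → j ≤ k → ∃ λ S → Indep M S × Indep N S × ∣ S ∣ ≡ j
  common-indep zero    _   = _ , ⊥-indep M , ⊥-indep N , ∣⊥∣≡0 n
  common-indep (suc j) j<k with common-indep j (<⇒≤ j<k)
  ... | S , M-indep , N-indep , refl = augment-common M-indep N-indep j<k

  adjacent : IsVertex S → ¬ M.Cl S x → Indep N J → J ⊆ S ⊕ x → x ∈ J → ∣ J ∣ ≡ k → Adj S J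
  adjacent {S} {x} {J} vS@(M-indep , N-indep , ∣S∣≡k) S∌x J-indep J⊆S⊕x x∈J ∣J∣≡k =
      (vS , hereditary M J⊆S⊕x S⊕x-indep , J-indep , ∣J∣≡k)
    , subst (Indep M) (sym S∪J≡S⊕x) S⊕x-indep
    , trans (cong ∣_∣ S∪J≡S⊕x) (trans (∣X⊕x∣≡1+∣X∣ (S∌x ∘ M.cl-extensive)) (trans (cong suc ∣S∣≡k) (+-comm 1 k)))
    where
    S⊕x-indep : Indep M (S ⊕ x)
    S⊕x-indep = M.∉cl⇒indep M-indep S∌x
    S∪J≡S⊕x : S ∪ J ≡ S ⊕ x
    S∪J≡S⊕x = ⊆-antisym (λ w∈ → [ X⊆X⊕x , J⊆S⊕x ]′ (x∈p∪q⁻ S J w∈)) (⊕-⊆ (p⊆p∪q J) (q⊆p∪q S J x∈J))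

  -- `I ⊕ x` is filled up from `S` to cardinality `k`; the result stays inside the M-independent set
  -- `S ⊕ x`.
  move : IsVertex S → I ⊆ S → ∣ I ∣ < k → ¬ M.Cl S x → ¬ N.Cl I x → ∃ λ A → Adj S A × I ⊆ A × x ∈ A
  move {S} {I} {x} vS@(_ , N-indep , ∣S∣≡k) I⊆S ∣I∣<k S∌x I∌x
    with N.extend (N.∉cl⇒indep (hereditary N I⊆S N-indep) I∌x) N-indep
           (subst (_≤ ∣ S ∣) (sym (∣X⊕x∣≡1+∣X∣ (I∌x ∘ N.cl-extensive))) (subst (∣ I ∣ <_) (sym ∣S∣≡k) ∣I∣<k))
  ... | A , A-indep , I⊕x⊆A , A⊆I⊕x∪S , ∣A∣≡∣S∣ =
    A , adjacent vS S∌x A-indep (λ w∈A → [ ⊕-mono I⊆S , X⊆X⊕x ]′ (x∈p∪q⁻ (I ⊕ x) S (A⊆I⊕x∪S w∈A)))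
          (I⊕x⊆A x∈X⊕x) (trans ∣A∣≡∣S∣ ∣S∣≡k)
      , I⊕x⊆A ∘ X⊆X⊕x , I⊕x⊆A x∈X⊕x

  -- `d` counts the elements that the common part `I` lacks; the statement is named so that it can
  -- be passed on as induction hypothesis.
  Joined : ℕ → Set
  Joined d = ∀ {S T I} → IsVertex S → IsVertex T → I ⊆ S → I ⊆ T → d + ∣ I ∣ ≡ k → Star Adj S T

  ∣I∣<k : ∀ {d} → suc d + ∣ I ∣ ≡ k → ∣ I ∣ < k
  ∣I∣<k {I = I} {d} eq = subst (∣ I ∣ <_) eq (s≤s (m≤n+m ∣ I ∣ d))

  approach : ∀ {d S T I t} → Joined d → IsVertex S → IsVertex T → I ⊆ S → I ⊆ T → suc d + ∣ I ∣ ≡ k →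
             t ∈ T → ¬ M.Cl S t → Star Adj S T
  approach {d} {S} {T} {I} {t} joined vS vT@(_ , T-indep , _) I⊆S I⊆T eq t∈T S∌t =
    let A , adj , I⊆A , t∈A = move vS I⊆S (∣I∣<k {I = I} eq) S∌t
          (N.indep⇒∉cl (hereditary N (⊕-⊆ I⊆T t∈T) T-indep) t∉I)
    in adj ◅ joined (proj₂ (adj-vertex adj)) vT (⊕-⊆ I⊆A t∈A) (⊕-⊆ I⊆T t∈T)
               (trans (cong (d +_) (∣X⊕x∣≡1+∣X∣ t∉I)) (trans (+-suc d ∣ I ∣) eq))
    where
    t∉I : t ∉ I
    t∉I t∈I = S∌t (M.cl-extensive (I⊆S t∈I))

  -- Otherwise `A` would span `T ⊕ a`, whose rank exceeds `∣ T ∣ = ∣ A ∣`.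
  escape : ∀ {A T a} → IsVertex A → IsVertex T → a ∈ A → ¬ M.Cl T a → ∃ λ t → t ∈ T × ¬ M.Cl A t
  escape {A} {T} {a} (_ , _ , ∣A∣≡k) (T-indep , _ , ∣T∣≡k) a∈A T∌a with M.escapes? T A
  ... | inj₁ found = found
  ... | inj₂ T⊆clA = contradiction
    (begin
      M.r (T ⊕ a) ≤⟨ M.spanned⇒r≤ (λ w∈ → [ T⊆clA , (λ { refl → M.cl-extensive a∈A }) ]′ (∈-⊕⁻ w∈)) ⟩
      M.r A       ≤⟨ M.r≤∣X∣ ⟩
      ∣ A ∣       ≡⟨ trans ∣A∣≡k (sym ∣T∣≡k) ⟩
      ∣ T ∣       ≤⟨ M.indep⇒∣I∣≤r T-indep id ⟩
      M.r T       ∎) T∌a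
    where open ≤-Reasoning

  swap-adj : IsVertex S → I ⊆ S → y ∈ I → ¬ M.Cl S x → N.Cl I x → ¬ N.Cl (I - y) x → Adj S (S - y ⊕ x)
  swap-adj vS@(_ , N-indep , ∣S∣≡k) I⊆S y∈I S∌x I∋x I-y∌x =
    adjacent vS S∌x (swap-indep N-indep I⊆S y∈I I∋x I-y∌x) (⊕-mono X-y⊆X) x∈X⊕x
      (trans (∣S-y⊕x∣≡∣S∣ (I⊆S y∈I) (S∌x ∘ M.cl-extensive)) ∣S∣≡k)

  -- The path refers to `S` only. Once `S` spans `T`, any `x` outside the M-closure of `S` is
  -- outside that of `T`, so `T` can follow each exchange.
  walk : ∀ {d} → Joined d → ∀ ps {S T I x} → IsVertex S → IsVertex T → I ⊆ S → I ⊆ T →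
         suc d + ∣ I ∣ ≡ k → ¬ M.Cl S x → Path S I x ps → Star Adj S T
  walk joined ps {S} {T} {I} {x} vS vT I⊆S I⊆T eq S∌x path with M.escapes? T S
  ... | inj₁ (t , t∈T , S∌t) = approach joined vS vT I⊆S I⊆T eq t∈T S∌t
  ... | inj₂ T⊆clS with N.cl? I x
  ...   | no I∌x =
    let A , adj , I⊆A , x∈A = move vS I⊆S (∣I∣<k {I = I} eq) S∌x I∌x
        vA = proj₂ (adj-vertex adj)
        t , t∈T , A∌t = escape vA vT x∈A (S∌x ∘ M.cl-trans T⊆clS)
    in adj ◅ approach joined vA vT I⊆A I⊆T eq t∈T A∌t
  walk joined [] _ _ _ _ _ _ I∌x | inj₂ _ | yes I∋x = contradiction I∋x I∌x
  walk joined ((y , z) ∷ ps) {S} {T} {I} {x} vS vT I⊆S I⊆T eq S∌x (y∈I , I-y∌x , S-y∌z , chordless , path)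
    | inj₂ T⊆clS | yes I∋x with M.cl? S z
  ... | no S∌z  = walk joined ps vS vT I⊆S I⊆T eq S∌z path
  ... | yes S∋z =
    let S-adj = swap-adj vS I⊆S y∈I S∌x I∋x I-y∌x
        T-adj = swap-adj vT I⊆T y∈I (S∌x ∘ M.cl-trans T⊆clS) I∋x I-y∌x
    -- One edge at each end; the recursive walk joins the two exchanged sets.
    in S-adj ◅ walk joined ps (proj₂ (adj-vertex S-adj)) (proj₂ (adj-vertex T-adj))
         (⊕-mono (-‿mono I⊆S)) (⊕-mono (-‿mono I⊆T))
         (trans (cong (suc _ +_) (∣S-y⊕x∣≡∣S∣ y∈I (x∉S ∘ I⊆S))) eq)
         (∉cl-⊕ X-y⊆X S-y∌z S∋z) (transfer ps chordless path)
       ◅◅ adj-sym T-adj ◅ ε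
    where open Step (proj₁ vS) I⊆S y∈I S∌x I∋x I-y∌x

  join : ∀ d → Joined d
  join zero {S} {T} {I} (_ , _ , ∣S∣≡k) (_ , _ , ∣T∣≡k) I⊆S I⊆T ∣I∣≡k
    with X⊆Y∧∣Y∣≤∣X∣⇒X≡Y I⊆S (≤-reflexive (trans ∣S∣≡k (sym ∣I∣≡k)))
       | X⊆Y∧∣Y∣≤∣X∣⇒X≡Y I⊆T (≤-reflexive (trans ∣T∣≡k (sym ∣I∣≡k)))
  ... | refl | refl = ε
  join (suc d) {I = I} vS@(S-indep , S-indepᴺ , ∣S∣≡k) vT I⊆S I⊆T eq =
    let x , ps , S∌x , path = path-exists S-indep (hereditary N I⊆S S-indepᴺ) I⊆S (∣I∣<k {I = I} eq) (≤-reflexive ∣S∣≡k)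
    in walk (join d) ps vS vT I⊆S I⊆T eq S∌x path

theorem5p3 : ∀ {n : ℕ} (M N : Matroid n) (k : ℕ) → k ≥ 1 →
    (∀ (X : Subset n) → IsFlat N (∁ X) → rank (N [ ∁ X ]) ≤ k ∸ 1 →
      rank (M [ X ]) + rank (N [ ∁ X ]) ≥ k + 1) →
    Connected (RG M N k)
theorem5p3 {n} M N k _ rank-condition =
    common-indep k ≤-refl
  -- The induction starts from the empty common part, which lacks all `k` elements.
  , λ vS vT → join k vS vT ⊥⊆ ⊥⊆ (trans (cong (k +_) (∣⊥∣≡0 n)) (+-identityʳ k))
  where open Reconfiguration M N k rank-condition
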